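{- Let $c>1$ be a constant. Given a set $S$ of $n$ boolean vectors of length $c\log n$, there is a data structure that uses $\tilde O(n^c)$ space and, upon receiving a query vector $v\in\{0,1\}^{c\log n}$, reports all $t$ vectors of $S$ that are orthogonal to $v$ in $O(t)$ time.
   Context: Vectors $u,v\in\{0,1\}^d$ are orthogonal if there is no coordinate $i$ with $u_i=v_i=1$. $\log$ is base 2 and $c\log n$ is rounded to an integer. The model is the standard word RAM with words of $\Theta(\log n)$ bits, so a vector of length $c\log n$ occupies $O(1)$ words; space is the size of the data structure produced by preprocessing. The quantity $t$ depends on the query; when $t=0$ the query time bound is understood as $O(1)$. The notation $\tilde O(f)$ suppresses all factors that are smaller than $n^{\eta}$ for every constant $\eta>0$. -}

module Defs where

open import Data.Bool using (Bool; true; false; if_then_else_; _∧_; _∨_; _xor_)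
open import Data.Fin using (Fin; toℕ; inject≤; finToFun; funToFin)
import Data.Fin as Fin
open import Data.Fin.Properties using (2↔Bool)
open import Data.Integer using (+_)
open import Data.List using (List; []; _∷_; _++_; [_]; length; concatMap; applyUpTo)
open import Data.List.Membership.Propositional using (_∈_)
open import Data.List.Relation.Unary.Unique.Propositional using (Unique)
open import Data.Nat using (ℕ; zero; suc; pred; _+_; _*_; _∸_; _^_; _/_; _≤_; _<_; _<ᵇ_; _⊔_; _≟_; NonZero)
open import Data.Nat.DivMod using (_mod_)
open import Data.Nat.Properties using (m^n≢0)
open import Data.Product using (_×_; ∃-syntax)
open import Data.Rational.Unnormalised as ℚᵘ using (ℚᵘ; 1ℚᵘ)
open import Data.Sum using (_⊎_)
open import Data.Vec using (Vec; []; _∷_; lookup)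
open import Function using (Inverse; _⇔_)
open import Relation.Binary using (DecidableEquality)
open import Relation.Binary.PropositionalEquality using (_≡_)
open import Relation.Nullary using (¬_; does)

-- Dedekind cuts: Lower q means q < x and Upper q means x < q.
record ℝ : Set₁ where
  field
    Lower Upper     : ℚᵘ → Set
    lower-inhabited : ∃[ q ] Lower q
    upper-inhabited : ∃[ q ] Upper q
    lower-closed    : ∀ {p q} → p ℚᵘ.< q → Lower q → Lower p
    upper-closed    : ∀ {p q} → p ℚᵘ.< q → Upper p → Upper q
    lower-open      : ∀ {p} → Lower p → ∃[ q ] (p ℚᵘ.< q × Lower q)
    upper-open      : ∀ {q} → Upper q → ∃[ p ] (p ℚᵘ.< q × Upper p)
    disjoint        : ∀ {q} → ¬ (Lower q × Upper q)
    located         : ∀ {p q} → p ℚᵘ.< q → Lower p ⊎ Upper q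

open ℝ public

1<_ : ℝ → Set
1< x = Lower x 1ℚᵘ

-- d is ⌊c log₂ n⌋ or ⌈c log₂ n⌉, i.e. d - 1 < c log₂ n < d + 1, for c > 0 and
-- n ≥ 2.  Here d - 1 < c log₂ n iff d - 1 < (p / q) log₂ n for some fraction
-- p / q < c, and the latter inequality is 2 ^ (d * q) < 2 ^ q * n ^ p.
-- Similarly for the upper bound.
RoundsLog : ℝ → ℕ → ℕ → Set
RoundsLog c n d =
  (∃[ p ] ∃[ q ] Lower c (+ p ℚᵘ./ suc q) × 2 ^ (d * suc q) < 2 ^ suc q * n ^ p) ×
  (∃[ p ] ∃[ q ] Upper c (+ p ℚᵘ./ suc q) × n ^ p < 2 ^ (suc d * suc q))

-- x ≤ y n^c for c > 0 and n ≥ 1: as n^c is the infimum of n^(p / q) over all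
-- fractions p / q > c, this says x ≤ y n^(p / q), i.e. x^q ≤ y^q n^p, for all
-- of them.
AtMost_TimesPower : ℕ → ℕ → ℕ → ℝ → Set
AtMost x TimesPower y n c =
  ∀ p q {{_ : NonZero q}} → Upper c (+ p ℚᵘ./ q) → x ^ q ≤ y ^ q * n ^ p

-- h is eventually below n^η for every fraction η = p / q > 0.
Subpolynomial : (ℕ → ℕ) → Set
Subpolynomial h =
  ∀ p q {{_ : NonZero p}} {{_ : NonZero q}} →
  ∃[ N ] ∀ n → N ≤ n → h n ^ q < n ^ p

-- κ₀ log₂ n ≤ w n ≤ κ₁ log₂ n
LogBounds : ℕ → ℕ → (ℕ → ℕ) → Set
LogBounds κ₀ κ₁ w = ∀ n → 2 ≤ n → n ^ κ₀ ≤ 2 ^ w n × 2 ^ w n ≤ n ^ κ₁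

Orthogonal : ∀ {d} → Vec Bool d → Vec Bool d → Set
Orthogonal u v = ¬ (∃[ i ] (lookup u i ≡ true × lookup v i ≡ true))

-- us lists every vector of S orthogonal to v exactly once.
ListsOrthogonal : ∀ {d} → List (Vec Bool d) → Vec Bool d → List (Vec Bool d) → Set
ListsOrthogonal S v us = Unique us × (∀ u → u ∈ us ⇔ (u ∈ S × Orthogonal u v))

-- The number whose binary digits are the entries, least significant first.
value : ∀ {d} → Vec Bool d → ℕ
value []       = 0
value (b ∷ bs) = (if b then 1 else 0) + 2 * value bs

data Op : Set where
  add sub mul div and or xor shl shr : Op

Reg : Set
Reg = ℕ

data Instr : Set where
  const  : (r : Reg) (k : ℕ) → Instr
  op     : Op → (r a b : Reg) → Instr
  load   : (r a : Reg) → Instr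
  store  : (a b : Reg) → Instr
  jump   : (l : ℕ) → Instr
  jumpEq : (a b : Reg) (l : ℕ) → Instr
  jumpLt : (a b : Reg) (l : ℕ) → Instr
  output : (a : Reg) → Instr
  halt   : Instr

Program : Set
Program = List Instr

-- Running past the end of the program halts.
fetch : Program → ℕ → Instr
fetch []      _       = halt
fetch (i ∷ _) zero    = i
fetch (_ ∷ p) (suc l) = fetch p l

update : {A B : Set} → DecidableEquality A → (A → B) → A → B → A → B
update _≟′_ f a b x = if does (x ≟′ a) then b else f x

module RAM (w : ℕ) where

  Word : Set
  Word = Fin (2 ^ w)

  word : ℕ → Word
  word x = _mod_ x (2 ^ w) {{m^n≢0 2 w}}

  bitwise : (Bool → Bool → Bool) → Word → Word → Word
  bitwise f a b = funToFin λ i → fromBool (f (bit a i) (bit b i))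
    where
    fromBool : Bool → Fin 2
    fromBool = Inverse.from 2↔Bool
    bit : Word → Fin w → Bool
    bit a i = Inverse.to 2↔Bool (finToFun a i)

  -- Division by zero gives zero.
  evalOp : Op → Word → Word → Word
  evalOp add a b = word (toℕ a + toℕ b)
  evalOp sub a b = word ((2 ^ w + toℕ a) ∸ toℕ b)
  evalOp mul a b = word (toℕ a * toℕ b)
  evalOp div a b with toℕ b
  ... | zero  = word 0
  ... | suc k = word (toℕ a / suc k)
  evalOp and a b = bitwise _∧_ a b
  evalOp or  a b = bitwise _∨_ a b
  evalOp xor a b = bitwise _xor_ a b
  evalOp shl a b = word (toℕ a * 2 ^ toℕ b)
  evalOp shr a b = word (_/_ (toℕ a) (2 ^ toℕ b) {{m^n≢0 2 (toℕ b)}})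

  Memory : Set
  Memory = Word → Word

  record State : Set where
    constructor state
    field
      pc   : ℕ
      regs : Reg → Word
      mem  : Memory
      out  : List Word

  open State public

  exec : Instr → State → State
  exec (const r k)    (state l R M o) = state (suc l) (update _≟_ R r (word k)) M o
  exec (op f r a b)   (state l R M o) = state (suc l) (update _≟_ R r (evalOp f (R a) (R b))) M o
  exec (load r a)     (state l R M o) = state (suc l) (update _≟_ R r (M (R a))) M o
  exec (store a b)    (state l R M o) = state (suc l) R (update Fin._≟_ M (R a) (R b)) o
  exec (jump l′)      (state l R M o) = state l′ R M o
  exec (jumpEq a b l′) (state l R M o) =
    state (if does (R a Fin.≟ R b) then l′ else suc l) R M o
  exec (jumpLt a b l′) (state l R M o) =
    state (if toℕ (R a) <ᵇ toℕ (R b) then l′ else suc l) R M o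
  exec (output a)     (state l R M o) = state (suc l) R M (o ++ [ R a ])
  exec halt           s               = s

  run : Program → ℕ → State → State
  run P zero    s = s
  run P (suc k) s = run P k (exec (fetch P (pc s)) s)

  Halted : Program → State → Set
  Halted P s = fetch P (pc s) ≡ halt

  -- The j-th block of w entries of v, as a word; it is 0 once v is exhausted.
  block : ∀ {d} → Vec Bool d → ℕ → Word
  block v j = word (_/_ (value v) (2 ^ (w * j)) {{m^n≢0 2 (w * j)}})

  -- A vector of length d occupies ⌈ d / w ⌉ words.
  encode : {{_ : NonZero w}} → ∀ {d} → Vec Bool d → List Word
  encode {d} v = applyUpTo (block v) ((d + pred w) / w)

  record DataStructure : Set where
    field
      size  : ℕ
      fits  : size ≤ 2 ^ w
      cells : Fin size → Word

  open DataStructure public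

  -- The structure occupies the memory cells 0, …, size - 1.
  Holds : Memory → DataStructure → Set
  Holds M D = ∀ i → M (inject≤ i (fits D)) ≡ cells D i

  -- The query vector is passed in registers 0, 1, …; all other registers are 0.
  initial : ∀ {d} → Vec Bool d → Memory → State
  initial v M = state 0 (block v) M []

  -- Nothing is assumed about the memory outside the structure, which serves as
  -- working space, and the structure is intact when the program halts; so
  -- queries can be asked one after another.
  AnswersQueries : {{_ : NonZero w}} → ∀ {d} →
    Program → (K : ℕ) → DataStructure → List (Vec Bool d) → Set
  AnswersQueries {d} P K D S =
    ∀ (v : Vec Bool d) (M : Memory) → Holds M D →
    ∃[ us ] ListsOrthogonal S v us ×
    ∃[ k ] k ≤ K * (1 ⊔ length us) ×
    (let s = run P k (initial v M) in
      Halted P s × out s ≡ concatMap encode us × Holds (mem s) D)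

module Submission where

-- Split S by the first coordinate into S₀ and S₁.  The vectors of S orthogonal to
-- 1v are those of S₀ orthogonal to v, and for 0v those of S₁ orthogonal to v are
-- added.  So the answers to all queries can be stored as binary trees that share
-- subtrees: each of the 2^i subsets reached after i splits adds at most
-- 2^(d-i-1) new forks, one for each query 0v whose two parts are both nonempty.
-- This makes d 2^(d-1) forks in all, and 2^d ≤ 2 n^c.  Every fork has two nonempty
-- subtrees, so the tree of a query with t answers has t - 1 forks and a
-- depth-first traversal lists its leaves in O(t) steps.

open import Defs
open import Data.Bool using (Bool; true; false; if_then_else_)
import Data.Bool.Properties as Bool
open import Data.Fin using (toℕ; inject≤; fromℕ<)
import Data.Fin as Fin
open import Data.Fin.Properties using (toℕ-fromℕ<; toℕ-injective; toℕ<n; toℕ-inject≤)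
open import Data.Integer using (+_; -[1+_]; ∣_∣)
import Data.Integer as ℤ
import Data.Integer.Properties as ℤ
open import Data.List using (List; []; _∷_; _++_; [_]; length; concatMap; applyUpTo; map)
open import Data.List.Membership.Propositional using (_∈_)
open import Data.List.Membership.Propositional.Properties using (∈-++⁺ˡ; ∈-++⁺ʳ; ∈-++⁻)
open import Data.List.Properties using (length-++; length-applyUpTo; map-++; ++-assoc; ++-identityʳ)
open import Data.List.Relation.Unary.All using ([]; _∷_)
open import Data.List.Relation.Unary.AllPairs using ([]; _∷_)
open import Data.List.Relation.Unary.Any using (here)
open import Data.List.Relation.Unary.Unique.Propositional using (Unique)
import Data.List.Relation.Unary.Unique.Propositional.Properties as Unique
open import Data.Nat
open import Data.Nat.Divisibility using (divides)
open import Data.Nat.DivMod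
open import Data.Nat.Logarithm
open import Data.Nat.Properties
open import Data.Nat.Tactic.RingSolver using (solve-∀)
open import Data.Product using (_×_; _,_; proj₁; ∃-syntax; Σ-syntax)
open import Data.Rational.Unnormalised as ℚᵘ using (mkℚᵘ; *<*)
import Data.Rational.Unnormalised.Properties as ℚᵘ
open import Data.Sum using (inj₁; inj₂)
open import Data.Vec using (Vec; []; _∷_)
open import Data.Vec.Properties using (≡-dec; ∷-injectiveʳ)
open import Function using (_∘_; Equivalence; mk⇔)
open import Relation.Binary.PropositionalEquality hiding ([_])
open import Relation.Nullary using (¬_; yes; no; does; contradiction)
open import Relation.Nullary.Decidable using (dec-true; dec-false)

-- The query program and its view of the memory

-- Cell 0 holds the boundary 1 + 2^d, cell 1 + value v the root for the query v, and
-- the boundary cell the address of the first free cell, where the stack starts.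
-- Register 0 is the current tree, 3 the boundary and 4 the stack pointer; 1 and 2
-- hold the constants 1 and 0.  The null pointer at the bottom of the stack ends
-- the loop, which starts at 8; 10 treats a fork and 16 a leaf.
search : Program
search =
  const 1 1 ∷
  const 2 0 ∷
  load 3 2 ∷
  load 4 3 ∷
  store 4 2 ∷
  op add 4 4 1 ∷
  op add 0 0 1 ∷
  load 0 0 ∷
  jumpEq 0 2 21 ∷
  jumpLt 0 3 16 ∷
  op add 5 0 1 ∷
  load 5 5 ∷
  store 4 5 ∷
  op add 4 4 1 ∷
  load 0 0 ∷
  jump 8 ∷
  op sub 0 0 1 ∷
  output 0 ∷
  op sub 4 4 1 ∷
  load 0 4 ∷
  jump 8 ∷
  []

module Image {d : ℕ} (N : ℕ → ℕ) (size : ℕ) where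

  -- Tree p h us: the pointer p represents a tree of height at most h with leaves us.
  -- Pointers up to 2^d are leaves (the pointer itself encodes the vector), larger
  -- ones are addresses of two cells pointing to the subtrees; 0 is the empty tree.
  data Tree : ℕ → ℕ → List (Vec Bool d) → Set where
    leaf : ∀ {h} u → Tree (suc (value u)) h [ u ]
    fork : ∀ {p h us vs} → 2 ^ d < p → suc p < size →
      Tree (N p) h us → Tree (N (suc p)) h vs → Tree p (suc h) (us ++ vs)

  data Answer : ℕ → ℕ → List (Vec Bool d) → Set where
    none : ∀ {h} → Answer 0 h []
    some : ∀ {p h us} → Tree p h us → Answer p h us

-- Word arithmetic and symbolic execution of the program

value<2^ : ∀ {d} (v : Vec Bool d) → value v < 2 ^ d
value<2^ [] = z<s
value<2^ {suc d} (b ∷ v) = begin-strict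
  (if b then 1 else 0) + 2 * value v <⟨ +-monoˡ-< (2 * value v) (bound b) ⟩
  2 + 2 * value v                    ≡⟨ regroup (value v) ⟩
  2 * suc (value v)                  ≤⟨ *-monoʳ-≤ 2 (value<2^ v) ⟩
  2 * 2 ^ d                          ∎
  where
  open ≤-Reasoning
  regroup : ∀ x → 2 + 2 * x ≡ 2 * suc x
  regroup = solve-∀
  bound : ∀ b → (if b then 1 else 0) < 2
  bound false = z<s
  bound true  = s<s z<s

module Words (w : ℕ) where
  open RAM w

  toℕ-word : ∀ {x} → x < 2 ^ w → toℕ (word x) ≡ x
  toℕ-word {x} x<2^w = trans (toℕ-fromℕ< _) (m<n⇒m%n≡m {{m^n≢0 2 w}} x<2^w)

  word-toℕ : ∀ a → word (toℕ a) ≡ a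
  word-toℕ a = toℕ-injective (toℕ-word (toℕ<n a))

  word-injective : ∀ {x y} → x < 2 ^ w → y < 2 ^ w → word x ≡ word y → x ≡ y
  word-injective x< y< eq = trans (sym (toℕ-word x<)) (trans (cong toℕ eq) (toℕ-word y<))

  add-word : ∀ {x y} → x < 2 ^ w → y < 2 ^ w → evalOp add (word x) (word y) ≡ word (x + y)
  add-word x< y< = cong₂ (λ x y → word (x + y)) (toℕ-word x<) (toℕ-word y<)

  pred-word : ∀ {x} → suc x < 2 ^ w → evalOp sub (word (suc x)) (word 1) ≡ word x
  pred-word {x} x< = begin
    word ((2 ^ w + toℕ (word (suc x))) ∸ toℕ (word 1))
      ≡⟨ cong₂ (λ x y → word ((2 ^ w + x) ∸ y)) (toℕ-word x<) (toℕ-word (≤-<-trans (s≤s z≤n) x<)) ⟩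
    word ((2 ^ w + suc x) ∸ 1)
      ≡⟨ cong (λ y → word (y ∸ 1)) (+-suc (2 ^ w) x) ⟩
    word (2 ^ w + x)
      ≡⟨ toℕ-injective (trans (toℕ-fromℕ< _) (trans lemma (sym (toℕ-fromℕ< _)))) ⟩
    word x ∎
    where
    open ≡-Reasoning
    lemma : _%_ (2 ^ w + x) (2 ^ w) {{m^n≢0 2 w}} ≡ _%_ x (2 ^ w) {{m^n≢0 2 w}}
    lemma = trans (cong (λ y → _%_ y (2 ^ w) {{m^n≢0 2 w}}) (+-comm (2 ^ w) x))
                  ([m+n]%n≡m%n x (2 ^ w) {{m^n≢0 2 w}})

  run-+ : ∀ P j k s → run P (j + k) s ≡ run P k (run P j s)
  run-+ P zero    k s = refl
  run-+ P (suc j) k s = run-+ P j k (exec (fetch P (pc s)) s)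

  -- A record, so that unification does not unfold run.
  record _⟶[_]_ (s : State) (k : ℕ) (s′ : State) : Set where
    constructor by
    field runs-to : run search k s ≡ s′
  open _⟶[_]_ public

  infixr 4 _⨟_
  _⨟_ : ∀ {s j s′ k s″} → s ⟶[ j ] s′ → s′ ⟶[ k ] s″ → s ⟶[ j + k ] s″
  _⨟_ {s} {j} {s′} {k} (by eq) (by eq′) =
    by (trans (run-+ search j k s) (trans (cong (run search k) eq) eq′))

  _[_↦_] : (Reg → Word) → Reg → Word → Reg → Word
  R [ r ↦ x ] = update _≟_ R r x

  -- A conditional jump does not reduce on unknown registers, so each branch gets its own lemma; the
  -- straight-line stretches between the jumps hold by `refl`.
  exit-step : ∀ {R M o} → R 0 ≡ R 2 → (state 8 R M o) ⟶[ 1 ] state 21 R M o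
  exit-step {R} {M} {o} eq = by
    (cong (λ b → state (if b then 21 else 9) R M o) (dec-true (R 0 Fin.≟ R 2) eq))

  enter-step : ∀ {R M o} → R 0 ≢ R 2 → (state 8 R M o) ⟶[ 1 ] state 9 R M o
  enter-step {R} {M} {o} ≢ = by
    (cong (λ b → state (if b then 21 else 9) R M o) (dec-false (R 0 Fin.≟ R 2) ≢))

  leaf-step : ∀ {R M o} → toℕ (R 0) < toℕ (R 3) → (state 9 R M o) ⟶[ 1 ] state 16 R M o
  leaf-step {R} {M} {o} lt =
    by (cong (λ b → state (if b then 16 else 10) R M o) (Equivalence.to Bool.T-≡ (<⇒<ᵇ lt)))

  fork-step : ∀ {R M o} → toℕ (R 0) ≮ toℕ (R 3) → (state 9 R M o) ⟶[ 1 ] state 10 R M o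
  fork-step {R} {M} {o} nlt = by (cong (λ b → state (if b then 16 else 10) R M o)
    (Bool.¬-not (nlt ∘ <ᵇ⇒< (toℕ (R 0)) (toℕ (R 3)) ∘ Equivalence.from Bool.T-≡)))

  leafRegs : (Reg → Word) → Memory → Reg → Word
  leafRegs R M = ((R [ 0 ↦ evalOp sub (R 0) (R 1) ]) [ 4 ↦ evalOp sub (R 4) (R 1) ])
                   [ 0 ↦ M (evalOp sub (R 4) (R 1)) ]

  leaf-steps : ∀ R M o → (state 16 R M o) ⟶[ 5 ]
    state 8 (leafRegs R M) M (o ++ [ evalOp sub (R 0) (R 1) ])
  leaf-steps R M o = by refl

  forkMem : (Reg → Word) → Memory → Memory
  forkMem R M = update Fin._≟_ M (R 4) (M (evalOp add (R 0) (R 1)))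

  forkRegs : (Reg → Word) → Memory → Reg → Word
  forkRegs R M =
    (((R [ 5 ↦ evalOp add (R 0) (R 1) ]) [ 5 ↦ M (evalOp add (R 0) (R 1)) ])
      [ 4 ↦ evalOp add (R 4) (R 1) ]) [ 0 ↦ forkMem R M (R 0) ]

  fork-steps : ∀ R M o → (state 10 R M o) ⟶[ 6 ] state 8 (forkRegs R M) (forkMem R M) o
  fork-steps R M o = by refl

  startRegs : (Reg → Word) → Memory → Reg → Word
  startRegs R M = (((((((R [ 1 ↦ word 1 ]) [ 2 ↦ word 0 ]) [ 3 ↦ M (word 0) ])
    [ 4 ↦ base ]) [ 4 ↦ evalOp add base (word 1) ])
    [ 0 ↦ evalOp add (R 0) (word 1) ]) [ 0 ↦ M₁ (evalOp add (R 0) (word 1)) ])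
    where
    base : Word
    base = M (M (word 0))
    M₁ : Memory
    M₁ = update Fin._≟_ M base (word 0)

  startMem : Memory → Memory
  startMem M = update Fin._≟_ M (M (M (word 0))) (word 0)

  start-steps : ∀ R M o → (state 0 R M o) ⟶[ 8 ] state 8 (startRegs R M) (startMem M) o
  start-steps R M o = by refl

  update-same : ∀ (M : Memory) {a} b {c} → c ≡ a → update Fin._≟_ M a b c ≡ b
  update-same M {a} b {c} c≡a rewrite dec-true (c Fin.≟ a) c≡a = refl

  update-other : ∀ (M : Memory) {a} b {c} → c ≢ a → update Fin._≟_ M a b c ≡ M c
  update-other M {a} b {c} c≢a rewrite dec-false (c Fin.≟ a) c≢a = refl

-- Depth-first traversal with an explicit stack

module Run (w : ℕ) {d : ℕ} (N : ℕ → ℕ) (size : ℕ) (2^d<size : 2 ^ d < size) where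
  open RAM w hiding (size)
  open Words w
  open Image {d} N size

  emit : Vec Bool d → Word
  emit u = word (value u)

  Intact : Memory → Set
  Intact M = ∀ {a} → a < size → M (word a) ≡ word (N a)

  -- The loop invariant at instruction 8. `sp` is the first cell above the stack.
  record Ready (R : Reg → Word) (M : Memory) (sp : ℕ) : Set where
    field
      one      : R 1 ≡ word 1
      zeroReg  : R 2 ≡ word 0
      boundary : R 3 ≡ word (suc (2 ^ d))
      stack    : R 4 ≡ word sp
      intact   : Intact M

  -- The tree has been listed and the next entry popped off the stack.  As each fork
  -- takes 8 steps and each leaf 7, t leaves take 15 t - 8 steps.
  record Outcome (p : ℕ) (us : List (Vec Bool d))
    (R : Reg → Word) (M : Memory) (o : List Word) (s : ℕ) : Set where
    field
      steps : ℕ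
      bound : steps + 8 ≤ 15 * length us
      R′    : Reg → Word
      M′    : Memory
      runs  : state 8 R M o ⟶[ steps ] state 8 R′ M′ (o ++ map emit us)
      ready : Ready R′ M′ s
      top   : R′ 0 ≡ M (word s)
      agree : ∀ {a} → toℕ a ≤ s → M′ a ≡ M a

  Tree<size : ∀ {p h us} → Tree p h us → p < size
  Tree<size (leaf u)       = ≤-<-trans (value<2^ u) 2^d<size
  Tree<size (fork _ p< _ _) = <-trans (n<1+n _) p<

  Tree≢0 : ∀ {p h us} → Tree p h us → p ≢ 0
  Tree≢0 (leaf u)       ()
  Tree≢0 (fork lt _ _ _) refl = n≮0 lt

  -- Induction on the tree. The stack grows from `size` upwards, so pushes leave the structure
  -- intact. Only forks whose left part is being traversed have an entry on the stack, so the height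
  -- bounds the number of cells needed from `suc s` on.
  traverse : ∀ {p h us} → Tree p h us → ∀ {s} → size ≤ s → suc s + h < 2 ^ w →
    ∀ {R M o} → Ready R M (suc s) → R 0 ≡ word p → Outcome p us R M o s
  traverse {p} {h} t {s} size≤s s+h< {R} {M} {o} rdy R0 = go t
    where
    open Ready rdy
    s< : suc s < 2 ^ w
    s< = m+n≤o⇒m≤o (suc (suc s)) s+h<
    size<2^w : size < 2 ^ w
    size<2^w = ≤-<-trans size≤s (<-trans (n<1+n s) s<)
    0<2^w : 0 < 2 ^ w
    0<2^w = ≤-<-trans z≤n s<
    1<2^w : 1 < 2 ^ w
    1<2^w = ≤-<-trans (s≤s z≤n) s<
    B< : suc (2 ^ d) < 2 ^ w
    B< = ≤-<-trans 2^d<size size<2^w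
    p<size : p < size
    p<size = Tree<size t
    p< : p < 2 ^ w
    p< = <-trans p<size size<2^w
    R0≢ : R 0 ≢ R 2
    R0≢ eq = Tree≢0 t (word-injective p< 0<2^w (trans (sym R0) (trans eq zeroReg)))
    R0≡p : toℕ (R 0) ≡ p
    R0≡p = trans (cong toℕ R0) (toℕ-word p<)
    R3≡B : toℕ (R 3) ≡ suc (2 ^ d)
    R3≡B = trans (cong toℕ boundary) (toℕ-word B<)
    go : ∀ {us} → Tree p h us → Outcome p us R M o s
    go (leaf u) = record
      { steps = 7
      ; bound = ≤-refl
      ; R′    = leafRegs R M
      ; M′    = M
      ; runs  = enter-step R0≢ ⨟ leaf-step (subst₂ _<_ (sym R0≡p) (sym R3≡B) (s<s (value<2^ u))) ⨟
          subst (λ a → state 16 R M o ⟶[ 5 ] state 8 (leafRegs R M) M (o ++ [ a ])) emitted (leaf-steps R M o)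
      ; ready = record
          { one = one ; zeroReg = zeroReg ; boundary = boundary
          ; stack = popped ; intact = intact }
      ; top   = cong M popped
      ; agree = λ _ → refl
      }
      where
      emitted : evalOp sub (R 0) (R 1) ≡ emit u
      emitted = trans (cong₂ (evalOp sub) R0 one) (pred-word p<)
      popped : evalOp sub (R 4) (R 1) ≡ word s
      popped = trans (cong₂ (evalOp sub) stack one) (pred-word s<)
    go (fork {h = h} {us} {vs} B≤p p+1<size l r) = record
      { steps = 8 + (L.steps + Q.steps)
      ; bound = bounded
      ; R′    = Q.R′
      ; M′    = Q.M′
      ; runs  = enter-step R0≢ ⨟ fork-step (subst₂ _≮_ (sym R0≡p) (sym R3≡B) (≤⇒≯ B≤p)) ⨟
          fork-steps R M o ⨟ L.runs ⨟
          subst (λ o′ → state 8 L.R′ L.M′ (o ++ map emit us) ⟶[ Q.steps ] state 8 Q.R′ Q.M′ o′)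
            (trans (++-assoc o _ _) (cong (o ++_) (sym (map-++ emit us vs)))) Q.runs
      ; ready = Q.ready
      -- `Q.top` reads cell `s` after the left traversal; `below` carries this back to the memory
      -- before the fork.
      ; top   = trans Q.top (below (≤-reflexive (toℕ-word (<-trans (n<1+n s) s<))))
      ; agree = λ a≤s → trans (Q.agree a≤s) (below a≤s)
      }
      where
      -- The pushed cell takes the place of one level of height.
      sh< : suc (suc s) + h < 2 ^ w
      sh< = ≤-trans (s≤s (≤-reflexive (cong suc (sym (+-suc s h))))) s+h<
      right : evalOp add (R 0) (R 1) ≡ word (suc p)
      right = trans (cong₂ (evalOp add) R0 one)
                (trans (add-word p< 1<2^w) (cong word (+-comm p 1)))
      pushed : evalOp add (R 4) (R 1) ≡ word (suc (suc s))
      pushed = trans (cong₂ (evalOp add) stack one)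
                (trans (add-word s< 1<2^w) (cong word (+-comm (suc s) 1)))
      M₁ : Memory
      M₁ = forkMem R M
      toℕ-R4 : toℕ (R 4) ≡ suc s
      toℕ-R4 = trans (cong toℕ stack) (toℕ-word s<)
      M₁-below : ∀ {a} → toℕ a ≤ s → M₁ a ≡ M a
      M₁-below {a} a≤s = update-other M _ λ a≡ →
        <⇒≢ (s≤s a≤s) (trans (cong toℕ a≡) toℕ-R4)
      intact₁ : Intact M₁
      intact₁ a< = trans
        (M₁-below (≤-trans (≤-reflexive (toℕ-word (<-trans a< size<2^w))) (≤-trans (<⇒≤ a<) size≤s)))
        (intact a<)
      outL : Outcome (N p) us (forkRegs R M) M₁ o (suc s)
      outL = traverse l (m≤n⇒m≤1+n size≤s) sh<
        (record { one = one ; zeroReg = zeroReg ; boundary = boundary ; stack = pushed ; intact = intact₁ })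
        (trans (cong M₁ R0) (intact₁ p<size))
      module L = Outcome outL
      -- The left traversal ends by popping cell `suc s`, to which the right pointer was pushed.
      outQ : Outcome (N (suc p)) vs L.R′ L.M′ (o ++ map emit us) s
      outQ = traverse r size≤s (≤-trans (s≤s (n≤1+n _)) sh<) L.ready
        (trans L.top (trans (update-same M _ (sym stack)) (trans (cong M right) (intact p+1<size))))
      module Q = Outcome outQ
      below : ∀ {a} → toℕ a ≤ s → L.M′ a ≡ M a
      below a≤s = trans (L.agree (m≤n⇒m≤1+n a≤s)) (M₁-below a≤s)
      shuffle : ∀ j k → 8 + (j + k) + 8 ≡ (j + 8) + (k + 8)
      shuffle = solve-∀
      bounded : 8 + (L.steps + Q.steps) + 8 ≤ 15 * length (us ++ vs)
      bounded = begin
        8 + (L.steps + Q.steps) + 8         ≡⟨ shuffle L.steps Q.steps ⟩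
        (L.steps + 8) + (Q.steps + 8)       ≤⟨ +-mono-≤ L.bound Q.bound ⟩
        15 * length us + 15 * length vs     ≡⟨ *-distribˡ-+ 15 (length us) (length vs) ⟨
        15 * (length us + length vs)        ≡⟨ cong (15 *_) (length-++ us) ⟨
        15 * length (us ++ vs)              ∎
        where open ≤-Reasoning

-- A complete query

module Query (w : ℕ) {d : ℕ} (N : ℕ → ℕ) (size : ℕ)
  (size+d< : suc size + d < 2 ^ w) (B<size : suc (2 ^ d) < size)
  (N0 : N 0 ≡ suc (2 ^ d)) (NB : N (suc (2 ^ d)) ≡ size) where
  open RAM w hiding (size)
  open Words w
  2^d<size : 2 ^ d < size
  2^d<size = <-trans (n<1+n _) B<size
  open Image {d} N size
  open Run w {d} N size 2^d<size

  -- The null entry goes into cell `size`, the first one beyond the structure. Start-up takes 8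
  -- steps and the exit 1, so t > 0 answers take at most 15 t + 1 steps.
  query : ∀ {us} (v : Vec Bool d) → Answer (N (suc (value v))) d us →
    ∀ {R M} → R 0 ≡ word (value v) → Intact M →
    ∃[ k ] k ≤ 16 * (1 ⊔ length us) × ∃[ R′ ] ∃[ M′ ]
      state 0 R M [] ⟶[ k ] state 21 R′ M′ (map emit us) × Intact M′
  query {us} v ans {R} {M} R0 intact = go ans refl
    where
    M₁ : Memory
    M₁ = startMem M
    size+1<2^w : suc size < 2 ^ w
    size+1<2^w = m+n≤o⇒m≤o (suc (suc size)) size+d<
    size<2^w : size < 2 ^ w
    size<2^w = <-trans (n<1+n size) size+1<2^w
    1<2^w : 1 < 2 ^ w
    1<2^w = ≤-<-trans (s≤s z≤n) size+1<2^w
    v<size : suc (value v) < size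
    v<size = ≤-<-trans (s≤s (<⇒≤ (value<2^ v))) B<size
    header : M (word 0) ≡ word (suc (2 ^ d))
    header = trans (intact (≤-<-trans z≤n B<size)) (cong word N0)
    base : M (M (word 0)) ≡ word size
    base = trans (cong M header) (trans (intact B<size) (cong word NB))
    intact₁ : Intact M₁
    intact₁ {a} a< = trans (update-other M _ λ eq →
      <⇒≢ a< (word-injective (<-trans a< size<2^w) size<2^w (trans eq base))) (intact a<)
    next : evalOp add (R 0) (word 1) ≡ word (suc (value v))
    next = trans (cong (λ x → evalOp add x (word 1)) R0)
      (trans (add-word (<-trans (<-trans (n<1+n _) v<size) size<2^w) 1<2^w) (cong word (+-comm (value v) 1)))
    ready : Ready (startRegs R M) M₁ (suc size)
    ready = record
      { one = refl ; zeroReg = refl ; boundary = header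
      ; stack = trans (cong (λ x → evalOp add x (word 1)) base)
          (trans (add-word size<2^w 1<2^w) (cong word (+-comm size 1)))
      ; intact = intact₁ }
    root : startRegs R M 0 ≡ word (N (suc (value v)))
    root = trans (cong M₁ next) (intact₁ v<size)
    go : ∀ {p us} → Answer p d us → p ≡ N (suc (value v)) →
      ∃[ k ] k ≤ 16 * (1 ⊔ length us) × ∃[ R′ ] ∃[ M′ ]
        state 0 R M [] ⟶[ k ] state 21 R′ M′ (map emit us) × Intact M′
    -- With a null root the loop is left at once: 8 steps of start-up and the exit.
    go none eq = 9 , m≤m+n 9 7 , startRegs R M , M₁ ,
      (start-steps R M [] ⨟ exit-step (trans root (cong word (sym eq)))) , intact₁
    go {us = us} (some t) eq = 8 + (O.steps + 1) , bounded , O.R′ , O.M′ ,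
      (start-steps R M [] ⨟ O.runs ⨟
       -- The entry popped last is the null pointer in cell `size`.
       exit-step (trans O.top (trans (update-same M _ (sym base)) (sym (Ready.zeroReg O.ready))))) ,
      Ready.intact O.ready
      where
      outcome : Outcome _ us (startRegs R M) M₁ [] size
      outcome = traverse t ≤-refl size+d< ready (trans root (cong word (sym eq)))
      module O = Outcome outcome
      shuffle : ∀ k → 8 + (k + 1) ≡ 1 + (k + 8)
      shuffle = solve-∀
      bounded : 8 + (O.steps + 1) ≤ 16 * (1 ⊔ length us)
      bounded = begin
        8 + (O.steps + 1)                    ≡⟨ shuffle O.steps ⟩
        1 + (O.steps + 8)                    ≤⟨ +-mono-≤ (m≤m⊔n 1 (length us)) O.bound ⟩
        (1 ⊔ length us) + 15 * length us     ≤⟨ +-monoʳ-≤ (1 ⊔ length us) (*-monoʳ-≤ 15 (m≤n⊔m 1 (length us))) ⟩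
        16 * (1 ⊔ length us)                 ∎
        where open ≤-Reasoning

-- Layout of the shared trees

-- One pair of cells for each query, in lexicographic order and whether or not both parts are
-- nonempty, so that `forkAddress` depends on `b` and the query alone.
forks : ∀ {m} → (Vec Bool m → ℕ) → (Vec Bool m → ℕ) → List ℕ
forks {zero}  f g = f [] ∷ g [] ∷ []
forks {suc m} f g =
  forks (f ∘ (false ∷_)) (g ∘ (false ∷_)) ++ forks (f ∘ (true ∷_)) (g ∘ (true ∷_))

forkAddress : ∀ {m} → ℕ → Vec Bool m → ℕ
forkAddress         b []          = b
forkAddress         b (false ∷ v) = forkAddress b v
forkAddress {suc m} b (true ∷ v)  = forkAddress (b + 2 ^ suc m) v

-- Passing a single nonempty part through keeps every fork binary, hence the number of forks in a
-- tree below its number of leaves.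
join : ℕ → ℕ → ℕ → ℕ
join zero      y         a = y
join x@(suc _) zero      a = x
join (suc _)   (suc _)   a = a

-- `σ` gives the leaf pointers and `b` is the first cell of the region described by `heap`. A query
-- that begins with 1 takes over the tree of S₀; this is where sharing occurs. The offsets are the
-- lengths of the preceding pieces of `heap`.
pointer : ∀ {m} → ℕ → (Vec Bool m → ℕ) → Vec Bool m → ℕ
pointer₀ pointer₁ : ∀ {m} → ℕ → (Vec Bool (suc m) → ℕ) → Vec Bool m → ℕ
pointer b σ []          = σ []
pointer b σ (true ∷ v)  = pointer₀ b σ v
pointer b σ (false ∷ v) = join (pointer₀ b σ v) (pointer₁ b σ v) (forkAddress b v)
pointer₀ {m} b σ = pointer (b + 2 ^ suc m) (σ ∘ (false ∷_))
pointer₁ {m} b σ = pointer ((b + 2 ^ suc m) + m * 2 ^ m) (σ ∘ (true ∷_))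

heap : ∀ {m} → ℕ → (Vec Bool m → ℕ) → List ℕ
heap {zero}  b σ = []
heap {suc m} b σ = forks (pointer₀ b σ) (pointer₁ b σ) ++
  heap (b + 2 ^ suc m) (σ ∘ (false ∷_)) ++
  heap ((b + 2 ^ suc m) + m * 2 ^ m) (σ ∘ (true ∷_))

length-forks : ∀ {m} (f g : Vec Bool m → ℕ) → length (forks f g) ≡ 2 ^ suc m
length-forks {zero}  f g = refl
length-forks {suc m} f g = trans (length-++ (forks (f ∘ (false ∷_)) _))
  (cong₂ _+_ (length-forks (f ∘ (false ∷_)) _)
    (trans (length-forks (f ∘ (true ∷_)) _) (sym (+-identityʳ _))))

-- The length solves the recurrence h(m + 1) = 2^(m + 1) + 2 h(m) with h(0) = 0.
length-heap : ∀ {m} b (σ : Vec Bool m → ℕ) → length (heap b σ) ≡ m * 2 ^ m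
length-heap {zero}  b σ = refl
length-heap {suc m} b σ = begin
  length (forks (pointer₀ b σ) (pointer₁ b σ) ++ heap _ (σ ∘ (false ∷_)) ++ heap _ (σ ∘ (true ∷_)))
    ≡⟨ length-++ (forks (pointer₀ b σ) _) ⟩
  length (forks (pointer₀ b σ) (pointer₁ b σ)) + length (heap _ (σ ∘ (false ∷_)) ++ heap _ (σ ∘ (true ∷_)))
    ≡⟨ cong₂ _+_ (length-forks (pointer₀ b σ) _) (length-++ (heap _ (σ ∘ (false ∷_)))) ⟩
  2 ^ suc m + (length (heap _ (σ ∘ (false ∷_))) + length (heap _ (σ ∘ (true ∷_))))
    ≡⟨ cong (_+_ (2 ^ suc m)) (cong₂ _+_ (length-heap _ (σ ∘ (false ∷_))) (length-heap _ (σ ∘ (true ∷_)))) ⟩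
  2 ^ suc m + (m * 2 ^ m + m * 2 ^ m)
    ≡⟨ cong (_+_ (2 ^ suc m)) (double m (2 ^ m)) ⟩
  suc m * 2 ^ suc m ∎
  where
  open ≡-Reasoning
  double : ∀ m x → m * x + m * x ≡ m * (2 * x)
  double = solve-∀

nth : List ℕ → ℕ → ℕ
nth []       _       = 0
nth (x ∷ xs) zero    = x
nth (x ∷ xs) (suc i) = nth xs i

nth-++ˡ : ∀ xs {ys i} → i < length xs → nth (xs ++ ys) i ≡ nth xs i
nth-++ˡ (x ∷ xs) {i = zero}  i<       = refl
nth-++ˡ (x ∷ xs) {i = suc i} (s≤s i<) = nth-++ˡ xs i<

nth-++ʳ : ∀ xs {ys} i → nth (xs ++ ys) (length xs + i) ≡ nth ys i
nth-++ʳ []       i = refl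
nth-++ʳ (x ∷ xs) i = nth-++ʳ xs i

nth-applyUpTo : ∀ f {n i} → i < n → nth (applyUpTo f n) i ≡ f i
nth-applyUpTo f {suc n} {zero}  i<       = refl
nth-applyUpTo f {suc n} {suc i} (s≤s i<) = nth-applyUpTo (f ∘ suc) i<

-- The trees list the answers

-- The specification of the trees: the recursion of `pointer` with concatenation in place of `join`,
-- on a family `S` of lists over the cube.
answers : ∀ {A : Set} {m} → (Vec Bool m → List A) → Vec Bool m → List A
answers S []          = S []
answers S (true ∷ v)  = answers (S ∘ (false ∷_)) v
answers S (false ∷ v) = answers (S ∘ (false ∷_)) v ++ answers (S ∘ (true ∷_)) v

module Layout {d : ℕ} (N : ℕ → ℕ) (size : ℕ) where
  open Image {d} N size

  Segment : ℕ → List ℕ → Set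
  Segment b xs = ∀ {i} → i < length xs → b + i < size × N (b + i) ≡ nth xs i

  segmentˡ : ∀ {b} xs {ys} → Segment b (xs ++ ys) → Segment b xs
  segmentˡ xs {ys} seg i<
    with seg (≤-trans i< (≤-trans (m≤m+n _ (length ys)) (≤-reflexive (sym (length-++ xs)))))
  ... | <size , eq = <size , trans eq (nth-++ˡ xs i<)

  segmentʳ : ∀ {b} xs {ys l} → length xs ≡ l → Segment b (xs ++ ys) → Segment (b + l) ys
  segmentʳ {b} xs {ys} refl seg {i} i<
    with seg (≤-trans (+-monoʳ-< (length xs) i<) (≤-reflexive (sym (length-++ xs))))
  ... | <size , eq rewrite +-assoc b (length xs) i = <size , trans eq (nth-++ʳ xs i)

  -- In `pointer-answer` the block starts above 2^d; `b ≤ a` then keeps fork addresses apart from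
  -- leaf pointers.
  fork-cells : ∀ {m} b (f g : Vec Bool m → ℕ) → Segment b (forks f g) → ∀ v →
    let a = forkAddress b v in b ≤ a × suc a < size × N a ≡ f v × N (suc a) ≡ g v
  fork-cells b f g seg [] with seg {0} z<s | seg {1} (s<s z<s)
  ... | _ , eq₀ | <size , eq₁ =
    ≤-refl , subst (_< size) (+-comm b 1) <size ,
    trans (cong N (sym (+-identityʳ b))) eq₀ , trans (cong N (+-comm 1 b)) eq₁
  fork-cells b f g seg (false ∷ v) =
    fork-cells b (f ∘ (false ∷_)) (g ∘ (false ∷_)) (segmentˡ (forks (f ∘ (false ∷_)) _) seg) v
  fork-cells {suc m} b f g seg (true ∷ v)
    with fork-cells (b + 2 ^ suc m) (f ∘ (true ∷_)) (g ∘ (true ∷_))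
      (segmentʳ (forks (f ∘ (false ∷_)) _) (length-forks (f ∘ (false ∷_)) _) seg) v
  ... | b≤a , rest = ≤-trans (m≤m+n b _) b≤a , rest

  raise : ∀ {p h us} → Tree p h us → Tree p (suc h) us
  raise (leaf u)          = leaf u
  raise (fork b≤ p< l r) = fork b≤ p< (raise l) (raise r)

  raise-answer : ∀ {p h us} → Answer p h us → Answer p (suc h) us
  raise-answer none     = none
  raise-answer (some t) = some (raise t)

  join-answer : ∀ {x y a h us vs} → 2 ^ d < a → suc a < size → N a ≡ x → N (suc a) ≡ y →
    Answer x h us → Answer y h vs → Answer (join x y a) (suc h) (us ++ vs)
  join-answer _ _ _ _ none ans = raise-answer ans
  -- No tree has a null pointer: leaf pointers are successors, and fork addresses exceed 2^d.
  join-answer {zero} _ _ _ _ (some (fork () _ _ _)) _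
  join-answer {suc x} _ _ _ _ ans@(some _) none =
    subst (Answer _ _) (sym (++-identityʳ _)) (raise-answer ans)
  join-answer {suc x} {zero} _ _ _ _ (some _) (some (fork () _ _ _))
  join-answer {suc x} {suc y} {h = h} {us} {vs} a> a< eqx eqy (some l) (some r) =
    some (fork a> a< (subst (λ p → Tree p h us) (sym eqx) l) (subst (λ p → Tree p h vs) (sym eqy) r))

  -- Induction on the number of remaining coordinates: the segment splits into the forks and the two
  -- smaller heaps at just the offsets used by `pointer`. Each split adds at most one level, so the
  -- height, and with it the stack, stays within the number of coordinates.
  pointer-answer : ∀ {m b} (S : Vec Bool m → List (Vec Bool d)) (σ : Vec Bool m → ℕ) →
    (∀ u → Answer (σ u) 0 (S u)) → 2 ^ d < b → Segment b (heap b σ) →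
    ∀ v → Answer (pointer b σ v) m (answers S v)
  pointer-answer S σ leaves b> seg [] = leaves []
  pointer-answer {suc m} {b} S σ leaves b> seg (bit ∷ v) = go bit
    where
    b₀ = b + 2 ^ suc m
    F = forks (pointer₀ b σ) (pointer₁ b σ)
    H₀ = heap b₀ (σ ∘ (false ∷_))
    seg₀ : Segment b₀ (H₀ ++ heap (b₀ + m * 2 ^ m) (σ ∘ (true ∷_)))
    seg₀ = segmentʳ F (length-forks (pointer₀ b σ) _) seg
    b₀> : 2 ^ d < b₀
    b₀> = ≤-trans b> (m≤m+n b _)
    ans₀ : Answer (pointer₀ b σ v) m (answers (S ∘ (false ∷_)) v)
    ans₀ = pointer-answer _ (σ ∘ (false ∷_)) (leaves ∘ (false ∷_)) b₀> (segmentˡ H₀ seg₀) v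
    ans₁ : Answer (pointer₁ b σ v) m (answers (S ∘ (true ∷_)) v)
    ans₁ = pointer-answer _ (σ ∘ (true ∷_)) (leaves ∘ (true ∷_)) (≤-trans b₀> (m≤m+n b₀ _))
      (segmentʳ H₀ (length-heap b₀ (σ ∘ (false ∷_))) seg₀) v
    go : ∀ bit → Answer (pointer b σ (bit ∷ v)) (suc m) (answers S (bit ∷ v))
    go true  = raise-answer ans₀
    go false with fork-cells b (pointer₀ b σ) (pointer₁ b σ) (segmentˡ F seg) v
    ... | b≤a , a< , eq₀ , eq₁ = join-answer (≤-trans b> b≤a) a< eq₀ eq₁ ans₀ ans₁

-- The memory image: root table and heap

bits : ∀ d → ℕ → Vec Bool d
bits zero    _ = []
bits (suc d) i = (0 <ᵇ i % 2) ∷ bits d (i / 2)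

-- The root table is filled by number but consulted by vector, so the index of a cell must give back
-- its query.
bits-value : ∀ {d} (v : Vec Bool d) → bits d (value v) ≡ v
bits-value []      = refl
bits-value (b ∷ v) = cong₂ _∷_ (low b) (trans (cong (bits _) (high b)) (bits-value v))
  where
  x = value v
  swap : ∀ k → (k + 2 * x) % 2 ≡ k % 2
  swap k = trans (cong (λ y → (k + y) % 2) (*-comm 2 x)) ([m+kn]%n≡m%n k x 2)
  low : ∀ b → (0 <ᵇ ((if b then 1 else 0) + 2 * x) % 2) ≡ b
  low false = cong (0 <ᵇ_) (swap 0)
  low true  = cong (0 <ᵇ_) (swap 1)
  half : ∀ k → (k + 2 * x) / 2 ≡ k / 2 + x
  half k = trans (+-distrib-/-∣ʳ k (divides x (*-comm 2 x)))
    (cong (_+_ (k / 2)) (trans (cong (_/ 2) (*-comm 2 x)) (m*n/n≡m x 2)))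
  high : ∀ b → ((if b then 1 else 0) + 2 * x) / 2 ≡ x
  high false = half 0
  high true  = half 1

-- Two cells for the boundary and the address of the first free cell, 2^d roots, and d 2^d cells of
-- forks.
imageSize : ℕ → ℕ
imageSize d = 2 + 2 ^ d + d * 2 ^ d

roots : ∀ {d} → (Vec Bool d → ℕ) → List ℕ
roots {d} σ = applyUpTo (pointer (2 + 2 ^ d) σ ∘ bits d) (2 ^ d)

image : ∀ {d} → (Vec Bool d → ℕ) → List ℕ
image {d} σ = suc (2 ^ d) ∷ roots σ ++ imageSize d ∷ heap (2 + 2 ^ d) σ

length-roots : ∀ {d} (σ : Vec Bool d → ℕ) → length (roots σ) ≡ 2 ^ d
length-roots {d} σ = length-applyUpTo (pointer (2 + 2 ^ d) σ ∘ bits d) (2 ^ d)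

length-image : ∀ {d} (σ : Vec Bool d → ℕ) → length (image σ) ≡ imageSize d
length-image {d} σ = cong suc (begin
  length (roots σ ++ imageSize d ∷ heap (2 + 2 ^ d) σ)     ≡⟨ length-++ (roots σ) ⟩
  length (roots σ) + suc (length (heap (2 + 2 ^ d) σ))     ≡⟨ cong₂ (λ x y → x + suc y) (length-roots σ) (length-heap _ σ) ⟩
  2 ^ d + suc (d * 2 ^ d)                                  ≡⟨ +-suc (2 ^ d) _ ⟩
  suc (2 ^ d + d * 2 ^ d)                                  ∎)
  where open ≡-Reasoning

image-boundary : ∀ {d} (σ : Vec Bool d → ℕ) → nth (image σ) (suc (2 ^ d)) ≡ imageSize d
image-boundary {d} σ = trans
  (cong (nth (roots σ ++ imageSize d ∷ heap (2 + 2 ^ d) σ)) (sym (trans (+-identityʳ _) (length-roots σ))))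
  (nth-++ʳ (roots σ) 0)

image-root : ∀ {d} (σ : Vec Bool d → ℕ) v →
  nth (image σ) (suc (value v)) ≡ pointer (2 + 2 ^ d) σ v
image-root {d} σ v = begin
  nth (roots σ ++ imageSize d ∷ heap (2 + 2 ^ d) σ) (value v)
    ≡⟨ nth-++ˡ (roots σ) (subst (value v <_) (sym (length-roots σ)) (value<2^ v)) ⟩
  nth (roots σ) (value v)
    ≡⟨ nth-applyUpTo _ (value<2^ v) ⟩
  pointer (2 + 2 ^ d) σ (bits d (value v))
    ≡⟨ cong (pointer (2 + 2 ^ d) σ) (bits-value v) ⟩
  pointer (2 + 2 ^ d) σ v ∎
  where open ≡-Reasoning

image-answer : ∀ {d} (S : Vec Bool d → List (Vec Bool d)) (σ : Vec Bool d → ℕ) →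
  let open Image {d} (nth (image σ)) (imageSize d) in
  (∀ u → Answer (σ u) 0 (S u)) → ∀ v → Answer (nth (image σ) (suc (value v))) d (answers S v)
image-answer {d} S σ leaves v = subst (λ p → Answer p d (answers S v)) (sym (image-root σ v))
  (pointer-answer S σ leaves (n≤1+n _) heap-segment v)
  where
  open Image {d} (nth (image σ)) (imageSize d)
  open Layout {d} (nth (image σ)) (imageSize d)
  prefix : List ℕ
  prefix = suc (2 ^ d) ∷ roots σ ++ [ imageSize d ]
  prefix-image : prefix ++ heap (2 + 2 ^ d) σ ≡ image σ
  prefix-image = cong (suc (2 ^ d) ∷_) (++-assoc (roots σ) _ _)
  whole : Segment 0 (prefix ++ heap (2 + 2 ^ d) σ)
  whole {i} i< = subst (i <_) (trans (cong length prefix-image) (length-image σ)) i< ,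
    cong (λ xs → nth xs i) (sym prefix-image)
  heap-segment : Segment (2 + 2 ^ d) (heap (2 + 2 ^ d) σ)
  heap-segment = segmentʳ prefix
    (cong suc (trans (length-++ (roots σ)) (trans (cong (_+ 1) (length-roots σ)) (+-comm (2 ^ d) 1)))) whole

-- The answers are the orthogonal vectors, each once

module _ {A : Set} where

  answers-sound : ∀ {m} (S : Vec Bool m → List A) v {x} → x ∈ answers S v →
    ∃[ u ] Orthogonal u v × x ∈ S u
  answers-sound S [] x∈ = [] , (λ { (() , _) }) , x∈
  answers-sound S (true ∷ v) x∈ with answers-sound (S ∘ (false ∷_)) v x∈
  -- At coordinate 0 one of the entries is `false`, so only successor indices remain.
  ... | u , u⊥v , x∈S = false ∷ u , (λ { (Fin.suc i , both) → u⊥v (i , both) }) , x∈S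
  answers-sound S (false ∷ v) x∈ with ∈-++⁻ (answers (S ∘ (false ∷_)) v) x∈
  ... | inj₁ x∈₀ with answers-sound (S ∘ (false ∷_)) v x∈₀
  ...   | u , u⊥v , x∈S = false ∷ u , (λ { (Fin.suc i , both) → u⊥v (i , both) }) , x∈S
  answers-sound S (false ∷ v) x∈ | inj₂ x∈₁ with answers-sound (S ∘ (true ∷_)) v x∈₁
  ...   | u , u⊥v , x∈S = true ∷ u , (λ { (Fin.suc i , both) → u⊥v (i , both) }) , x∈S

  answers-complete : ∀ {m} (S : Vec Bool m → List A) u v {x} →
    Orthogonal u v → x ∈ S u → x ∈ answers S v
  answers-complete S [] [] u⊥v x∈ = x∈
  answers-complete S (false ∷ u) (true ∷ v) u⊥v x∈ =
    answers-complete (S ∘ (false ∷_)) u v (λ (i , both) → u⊥v (Fin.suc i , both)) x∈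
  answers-complete S (true ∷ u) (true ∷ v) u⊥v x∈ = contradiction (Fin.zero , refl , refl) u⊥v
  answers-complete S (false ∷ u) (false ∷ v) u⊥v x∈ =
    ∈-++⁺ˡ (answers-complete (S ∘ (false ∷_)) u v (λ (i , both) → u⊥v (Fin.suc i , both)) x∈)
  answers-complete S (true ∷ u) (false ∷ v) u⊥v x∈ =
    ∈-++⁺ʳ (answers (S ∘ (false ∷_)) v)
      (answers-complete (S ∘ (true ∷_)) u v (λ (i , both) → u⊥v (Fin.suc i , both)) x∈)

  -- Lists that get concatenated come from vectors with different first coordinates, so they have no
  -- common element.
  answers-unique : ∀ {m} (S : Vec Bool m → List A) → (∀ u → Unique (S u)) →
    (∀ {x u u′} → x ∈ S u → x ∈ S u′ → u ≡ u′) → ∀ v → Unique (answers S v)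
  answers-unique S each disjoint [] = each []
  answers-unique S each disjoint (true ∷ v) =
    answers-unique (S ∘ (false ∷_)) (each ∘ (false ∷_)) (λ x∈ x∈′ → ∷-injectiveʳ (disjoint x∈ x∈′)) v
  answers-unique S each disjoint (false ∷ v) = Unique.++⁺
    (answers-unique (S ∘ (false ∷_)) (each ∘ (false ∷_)) (λ x∈ x∈′ → ∷-injectiveʳ (disjoint x∈ x∈′)) v)
    (answers-unique (S ∘ (true ∷_)) (each ∘ (true ∷_)) (λ x∈ x∈′ → ∷-injectiveʳ (disjoint x∈ x∈′)) v)
    λ (x∈₀ , x∈₁) → apart (answers-sound (S ∘ (false ∷_)) v x∈₀) (answers-sound (S ∘ (true ∷_)) v x∈₁)
    where
    apart : ∀ {x} → (∃[ u ] Orthogonal u v × x ∈ S (false ∷ u)) →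
      ¬ (∃[ u ] Orthogonal u v × x ∈ S (true ∷ u))
    apart (_ , _ , x∈) (_ , _ , x∈′) with disjoint x∈ x∈′
    ... | ()

module Members {d : ℕ} (S : List (Vec Bool d)) where
  open import Data.List.Membership.DecPropositional (≡-dec {n = d} Bool._≟_) using (_∈?_)

  -- `S` as a family of lists over the cube, the form taken by `answers`.
  member : Vec Bool d → List (Vec Bool d)
  member u = if does (u ∈? S) then [ u ] else []

  leafPointer : Vec Bool d → ℕ
  leafPointer u = if does (u ∈? S) then suc (value u) else 0

  leaf-answer : ∀ N size → let open Image {d} N size in ∀ u → Answer (leafPointer u) 0 (member u)
  leaf-answer N size u with u ∈? S
  ... | yes _ = some (leaf u)
    where open Image {d} N size
  ... | no  _ = none
    where open Image {d} N size

  member-sound : ∀ {x} u → x ∈ member u → x ≡ u × u ∈ S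
  member-sound u x∈ with u ∈? S
  member-sound u (here refl) | yes u∈S = refl , u∈S
  member-sound u ()          | no _

  member-complete : ∀ {u} → u ∈ S → u ∈ member u
  member-complete {u} u∈S with u ∈? S
  ... | yes _   = here refl
  ... | no  u∉S = contradiction u∈S u∉S

  member-unique : ∀ u → Unique (member u)
  member-unique u with u ∈? S
  ... | yes _ = [] ∷ []
  ... | no  _ = []

  lists-answers : ∀ v → ListsOrthogonal S v (answers member v)
  lists-answers v =
    answers-unique member member-unique
      (λ {_} {u} {u′} x∈ x∈′ → trans (sym (proj₁ (member-sound u x∈))) (proj₁ (member-sound u′ x∈′))) v ,
    λ u → mk⇔ (sound u) λ (u∈S , u⊥v) → answers-complete member u v u⊥v (member-complete u∈S)
    where
    sound : ∀ u → u ∈ answers member v → u ∈ S × Orthogonal u v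
    sound u u∈ with answers-sound member v u∈
    ... | u′ , u′⊥v , u∈′ with member-sound u′ u∈′
    ...   | refl , u∈S = u∈S , u′⊥v

-- In dimension 0 there is only one vector. Positivity matters because the empty vector is encoded
-- by no words, whereas the program outputs one word per answer.
0<dimension : ∀ {d} (S : List (Vec Bool d)) → Unique S → 2 ≤ length S → 0 < d
0<dimension {zero} ([] ∷ [] ∷ S) ((≢ ∷ _) ∷ _) _ = contradiction refl ≢
0<dimension {zero} (_ ∷ []) _ (s≤s ())
0<dimension {suc d} _ _ _ = z<s

-- Powers, cuts and the rounding of c log n

^-distribʳ-* : ∀ a b k → (a * b) ^ k ≡ a ^ k * b ^ k
^-distribʳ-* a b zero    = refl
^-distribʳ-* a b (suc k) = trans (cong (a * b *_) (^-distribʳ-* a b k)) (interchange a b (a ^ k) (b ^ k))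
  where
  interchange : ∀ a b x y → a * b * (x * y) ≡ a * x * (b * y)
  interchange = solve-∀

^-cancelˡ-≤ : ∀ {a b} q .{{_ : NonZero q}} → a ^ q ≤ b ^ q → a ≤ b
^-cancelˡ-≤ q aq≤bq = ≮⇒≥ λ b<a → <⇒≱ (^-monoˡ-< q b<a) aq≤bq

2^-cancel-< : ∀ {m n} → 2 ^ m < 2 ^ n → m < n
2^-cancel-< lt = ≰⇒> λ n≤m → <⇒≱ lt (^-monoʳ-≤ 2 n≤m)

2^-cancel-≤ : ∀ {m n} → 2 ^ m ≤ 2 ^ n → m ≤ n
2^-cancel-≤ le = ≮⇒≥ λ n<m → <⇒≱ (^-monoʳ-< 2 (s<s z<s) n<m) le

n<2^n : ∀ n → n < 2 ^ n
n<2^n zero    = z<s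
n<2^n (suc n) = begin-strict
  suc n         <⟨ s<s (n<2^n n) ⟩
  1 + 2 ^ n     ≤⟨ +-monoˡ-≤ (2 ^ n) (m^n>0 2 n) ⟩
  2 ^ n + 2 ^ n ≡⟨ cong (_+_ (2 ^ n)) (+-identityʳ (2 ^ n)) ⟨
  2 ^ suc n     ∎
  where open ≤-Reasoning

-- Openness gives x′ > x in the lower cut; y < x′ would put y into both cuts, so x < x′ ≤ y.
lower<upper : ∀ (c : ℝ) {x y} → Lower c x → Upper c y → x ℚᵘ.< y
lower<upper c {x} {y} Lx Uy with lower-open c Lx
... | x′ , x<x′ , Lx′ with y ℚᵘ.<? x′
...   | yes y<x′ = contradiction (lower-closed c y<x′ Lx′ , Uy) (disjoint c)
...   | no  y≮x′ = ℚᵘ.<-≤-trans x<x′ (ℚᵘ.≮⇒≥ y≮x′)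

fraction-< : ∀ {p q p′ q′} .{{_ : NonZero q}} .{{_ : NonZero q′}} →
  (+ p ℚᵘ./ q) ℚᵘ.< (+ p′ ℚᵘ./ q′) → p * q′ < p′ * q
fraction-< {p} {suc q} {p′} {suc q′} (*<* lt) =
  ℤ.drop‿+<+ (subst₂ ℤ._<_ (sym (ℤ.pos-* p (suc q′))) (sym (ℤ.pos-* p′ (suc q))) lt)

-- Rounding costs a factor of 2: 2^d < 2 n^(p/q), and p/q < p′/q′ as the fractions lie on either
-- side of `c`. To avoid roots, the inequality is proved for q-th powers of both sides and the
-- exponent `q` is cancelled.
rounding-bound : ∀ (c : ℝ) {n d p q} .{{_ : NonZero n}} .{{_ : NonZero q}} →
  Lower c (+ p ℚᵘ./ q) → 2 ^ (d * q) < 2 ^ q * n ^ p →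
  ∀ {p′ q′} .{{_ : NonZero q′}} → Upper c (+ p′ ℚᵘ./ q′) → (2 ^ d) ^ q′ ≤ 2 ^ q′ * n ^ p′
rounding-bound c {n} {d} {p} {q} L lt {p′} {q′} U = ^-cancelˡ-≤ q (begin
  ((2 ^ d) ^ q′) ^ q          ≡⟨ ^-swap (2 ^ d) q′ q ⟩
  ((2 ^ d) ^ q) ^ q′          ≡⟨ cong (_^ q′) (^-*-assoc 2 d q) ⟩
  (2 ^ (d * q)) ^ q′          ≤⟨ ^-monoˡ-≤ q′ (<⇒≤ lt) ⟩
  (2 ^ q * n ^ p) ^ q′        ≡⟨ ^-distribʳ-* (2 ^ q) (n ^ p) q′ ⟩
  (2 ^ q) ^ q′ * (n ^ p) ^ q′ ≡⟨ cong₂ _*_ (^-swap 2 q q′) (^-*-assoc n p q′) ⟩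
  (2 ^ q′) ^ q * n ^ (p * q′) ≤⟨ *-monoʳ-≤ ((2 ^ q′) ^ q) (^-monoʳ-≤ n (<⇒≤ (fraction-< (lower<upper c L U)))) ⟩
  (2 ^ q′) ^ q * n ^ (p′ * q) ≡⟨ cong ((2 ^ q′) ^ q *_) (^-*-assoc n p′ q) ⟨
  (2 ^ q′) ^ q * (n ^ p′) ^ q ≡⟨ ^-distribʳ-* (2 ^ q′) (n ^ p′) q ⟨
  (2 ^ q′ * n ^ p′) ^ q       ∎)
  where
  open ≤-Reasoning
  ^-swap : ∀ a m k → (a ^ m) ^ k ≡ (a ^ k) ^ m
  ^-swap a m k = trans (^-*-assoc a m k) (trans (cong (a ^_) (*-comm m k)) (sym (^-*-assoc a k m)))

-- An integer above `c` serves for the crude bound on `d`, and through it for the overhead and the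
-- word length.
natural-upper : (c : ℝ) → ∃[ U ] Upper c (+ U ℚᵘ./ 1)
natural-upper c with upper-inhabited c
... | mkℚᵘ num q , Uc = suc ∣ num ∣ , upper-closed c (*<* (num<bound num)) Uc
  where
  num<bound : ∀ num → num ℤ.* (+ 1) ℤ.< + suc ∣ num ∣ ℤ.* + suc q
  num<bound num = begin-strict
    num ℤ.* + 1           ≡⟨ ℤ.*-identityʳ num ⟩
    num                   ≤⟨ i≤∣i∣ num ⟩
    + ∣ num ∣             <⟨ ℤ.+<+ (≤-trans (n<1+n ∣ num ∣) (m≤m*n (suc ∣ num ∣) (suc q))) ⟩
    + (suc ∣ num ∣ * suc q)  ≡⟨ ℤ.pos-* (suc ∣ num ∣) (suc q) ⟩
    + suc ∣ num ∣ ℤ.* + suc q ∎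
    where
    open ℤ.≤-Reasoning
    i≤∣i∣ : ∀ i → i ℤ.≤ + ∣ i ∣
    i≤∣i∣ (+ n)    = ℤ.≤-refl
    i≤∣i∣ -[1+ n ] = ℤ.-≤+

-- Logarithms and the subpolynomial overhead

-- Induction on `k`: halving `n` lowers a positive logarithm by one.
⌊log₂⌋-upper : ∀ k {n} → n < 2 ^ suc k → ⌊log₂ n ⌋ ≤ k
⌊log₂⌋-upper zero    {zero}        _ = z≤n
⌊log₂⌋-upper zero    {suc zero}    _ = z≤n
⌊log₂⌋-upper zero    {suc (suc n)} (s≤s (s≤s ()))
⌊log₂⌋-upper (suc k) {n} n< = begin
  ⌊log₂ n ⌋                  ≤⟨ m≤n+m∸n ⌊log₂ n ⌋ 1 ⟩
  suc (⌊log₂ n ⌋ ∸ 1)        ≡⟨ cong suc (⌊log₂⌊n/2⌋⌋≡⌊log₂n⌋∸1 n) ⟨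
  suc ⌊log₂ ⌊ n /2⌋ ⌋        ≤⟨ s≤s (⌊log₂⌋-upper k {⌊ n /2⌋} (*-cancelˡ-< 2 _ _ (≤-<-trans double n<))) ⟩
  suc k                      ∎
  where
  open ≤-Reasoning
  double : 2 * ⌊ n /2⌋ ≤ n
  double = ≤-trans (+-monoʳ-≤ ⌊ n /2⌋ (≤-trans (≤-reflexive (+-identityʳ _)) (⌊n/2⌋≤⌈n/2⌉ n)))
    (≤-reflexive (⌊n/2⌋+⌈n/2⌉≡n n))

2^⌊log₂n⌋≤n : ∀ n .{{_ : NonZero n}} → 2 ^ ⌊log₂ n ⌋ ≤ n
2^⌊log₂n⌋≤n n = ≮⇒≥ (go _ refl)
  where
  go : ∀ l → l ≡ ⌊log₂ n ⌋ → n ≮ 2 ^ ⌊log₂ n ⌋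
  go zero    eq n< = <⇒≱ (subst (λ l → n < 2 ^ l) (sym eq) n<) (>-nonZero⁻¹ n)
  go (suc l) eq n< = <⇒≱ (≤-reflexive eq) (⌊log₂⌋-upper l (subst (λ l → n < 2 ^ l) (sym eq) n<))

n<2^[1+⌊log₂n⌋] : ∀ n → n < 2 ^ suc ⌊log₂ n ⌋
n<2^[1+⌊log₂n⌋] n = ≰⇒> λ le →
  <-irrefl refl (≤-trans (≤-reflexive (sym (⌊log₂[2^n]⌋≡n (suc ⌊log₂ n ⌋)))) (⌊log₂⌋-mono-≤ le))

-- Put k = ⌊l / 2q⌋ and D = 2qC. Then C (l + 1) ≤ D (k + 1), and once D ≤ k this is below 2^k 2^k,
-- whose q-th power 2^(2kq) is at most 2^l.
exponential-dominates : ∀ C q .{{_ : NonZero q}} →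
  ∃[ l₀ ] ∀ l → l₀ ≤ l → (C * suc l) ^ q < 2 ^ l
exponential-dominates C q@(suc _) = D * (q * 2) , λ l l₀≤l →
  let k = l / (q * 2)
      D≤k : D ≤ k
      D≤k = ≤-trans (≤-reflexive (sym (m*n/n≡m D (q * 2)))) (/-monoˡ-≤ (q * 2) l₀≤l)
      1+l≤ : suc l ≤ suc k * (q * 2)
      1+l≤ = begin
        suc l                              ≡⟨ cong suc (m≡m%n+[m/n]*n l (q * 2)) ⟩
        suc (l % (q * 2)) + k * (q * 2)    ≤⟨ +-monoˡ-≤ (k * (q * 2)) (m%n<n l (q * 2)) ⟩
        suc k * (q * 2)                    ∎
  in begin-strict
    (C * suc l) ^ q               ≤⟨ ^-monoˡ-≤ q (*-monoʳ-≤ C 1+l≤) ⟩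
    (C * (suc k * (q * 2))) ^ q   ≡⟨ cong (_^ q) (rearrange C k q) ⟩
    (D * suc k) ^ q               <⟨ ^-monoˡ-< q (*-monoˡ-< (suc k) (≤-<-trans D≤k (n<2^n k))) ⟩
    (2 ^ k * suc k) ^ q           ≤⟨ ^-monoˡ-≤ q (*-monoʳ-≤ (2 ^ k) (n<2^n k)) ⟩
    (2 ^ k * 2 ^ k) ^ q           ≡⟨ cong (_^ q) (^-distribˡ-+-* 2 k k) ⟨
    (2 ^ (k + k)) ^ q             ≡⟨ ^-*-assoc 2 (k + k) q ⟩
    2 ^ ((k + k) * q)             ≡⟨ cong (2 ^_) (twice k q) ⟩
    2 ^ (k * (q * 2))             ≤⟨ ^-monoʳ-≤ 2 (m/n*n≤m l (q * 2)) ⟩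
    2 ^ l                         ∎
  where
  open ≤-Reasoning
  D : ℕ
  D = C * (q * 2)
  rearrange : ∀ C k q → C * (suc k * (q * 2)) ≡ C * (q * 2) * suc k
  rearrange = solve-∀
  twice : ∀ k q → (k + k) * q ≡ k * (q * 2)
  twice = solve-∀

-- The factor 3 + d of `imageSize-bound`, with `d` replaced by its bound from `dimension-bound`,
-- times the 2 lost to rounding.
overhead : ℕ → ℕ → ℕ
overhead U n = (3 + (1 + suc ⌊log₂ n ⌋ * U)) * 2

-- The overhead is linear in ⌊log₂ n⌋, and n^(1/q) ≤ n^(p/q), so the exponent 1/q suffices.
overhead-subpolynomial : ∀ U → Subpolynomial (overhead U)
overhead-subpolynomial U p q with exponential-dominates ((4 + U) * 2) q
... | l₀ , dominates = 2 ^ l₀ , λ n 2^l₀≤n →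
  let l = ⌊log₂ n ⌋
      l₀≤l : l₀ ≤ l
      l₀≤l = ≤-trans (≤-reflexive (sym (⌊log₂[2^n]⌋≡n l₀))) (⌊log₂⌋-mono-≤ 2^l₀≤n)
      instance
        n≢0 : NonZero n
        n≢0 = >-nonZero (≤-trans (m^n>0 2 l₀) 2^l₀≤n)
  in begin-strict
    overhead U n ^ q             ≤⟨ ^-monoˡ-≤ q (linear l) ⟩
    ((4 + U) * 2 * suc l) ^ q    <⟨ dominates l l₀≤l ⟩
    2 ^ l                        ≤⟨ 2^⌊log₂n⌋≤n n ⟩
    n                            ≡⟨ ^-identityʳ n ⟨
    n ^ 1                        ≤⟨ ^-monoʳ-≤ n (>-nonZero⁻¹ p) ⟩
    n ^ p                        ∎
  where
  open ≤-Reasoning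
  linear : ∀ l → (3 + (1 + suc l * U)) * 2 ≤ (4 + U) * 2 * suc l
  linear l = ≤-trans (m≤m+n _ (8 * l)) (≤-reflexive (expand l U))
    where
    expand : ∀ l U → (3 + (1 + suc l * U)) * 2 + 8 * l ≡ (4 + U) * 2 * suc l
    expand = solve-∀

-- Bounds on the space and on the word length

dimension-bound : ∀ {d U n} → 2 ^ d ≤ 2 * n ^ U → d ≤ 1 + suc ⌊log₂ n ⌋ * U
dimension-bound {d} {U} {n} le = 2^-cancel-≤ (begin
  2 ^ d                              ≤⟨ le ⟩
  2 * n ^ U                          ≤⟨ *-monoʳ-≤ 2 (^-monoˡ-≤ U (<⇒≤ (n<2^[1+⌊log₂n⌋] n))) ⟩
  2 * (2 ^ suc ⌊log₂ n ⌋) ^ U        ≡⟨ cong (2 *_) (^-*-assoc 2 (suc ⌊log₂ n ⌋) U) ⟩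
  2 ^ (1 + suc ⌊log₂ n ⌋ * U)        ∎)
  where open ≤-Reasoning

imageSize-bound : ∀ d → imageSize d ≤ (3 + d) * 2 ^ d
imageSize-bound d = begin
  2 + 2 ^ d + d * 2 ^ d           ≤⟨ +-monoˡ-≤ (d * 2 ^ d) (+-monoˡ-≤ (2 ^ d) (*-monoʳ-≤ 2 (m^n>0 2 d))) ⟩
  2 * 2 ^ d + 2 ^ d + d * 2 ^ d   ≡⟨ collect d (2 ^ d) ⟩
  (3 + d) * 2 ^ d                 ∎
  where
  open ≤-Reasoning
  collect : ∀ d x → 2 * x + x + d * x ≡ (3 + d) * x
  collect = solve-∀

imageSize-atMost : ∀ {d n U p q} → 2 ^ d ≤ 2 * n ^ U → (2 ^ d) ^ q ≤ 2 ^ q * n ^ p →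
  imageSize d ^ q ≤ overhead U n ^ q * n ^ p
imageSize-atMost {d} {n} {U} {p} {q} le leq = begin
  imageSize d ^ q                  ≤⟨ ^-monoˡ-≤ q (imageSize-bound d) ⟩
  ((3 + d) * 2 ^ d) ^ q            ≡⟨ ^-distribʳ-* (3 + d) (2 ^ d) q ⟩
  (3 + d) ^ q * (2 ^ d) ^ q        ≤⟨ *-monoʳ-≤ ((3 + d) ^ q) leq ⟩
  (3 + d) ^ q * (2 ^ q * n ^ p)    ≡⟨ *-assoc ((3 + d) ^ q) (2 ^ q) (n ^ p) ⟨
  (3 + d) ^ q * 2 ^ q * n ^ p      ≡⟨ cong (_* n ^ p) (^-distribʳ-* (3 + d) 2 q) ⟨
  ((3 + d) * 2) ^ q * n ^ p        ≤⟨ *-monoˡ-≤ (n ^ p) (^-monoˡ-≤ q (*-monoˡ-≤ 2 (+-monoʳ-≤ 3 (dimension-bound {d} {U} {n} le)))) ⟩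
  overhead U n ^ q * n ^ p         ∎
  where open ≤-Reasoning

-- Structure and stack take at most 4 · 4^d ≤ 16 n^(2U) cells; the 5 absorbs the constant, as 16 <
-- 2^5 ≤ n^5.
wordExponent : ℕ → ℕ
wordExponent U = 5 + U * 2

memory-bound : ∀ {d n U} → 2 ≤ n → 2 ^ d ≤ 2 * n ^ U → suc (imageSize d) + d < n ^ wordExponent U
memory-bound {d} {n@(suc _)} {U} 2≤n le = begin-strict
  suc (imageSize d) + d              ≡⟨ regroup d x ⟩
  2 + suc d + suc d * x              ≤⟨ +-mono-≤ (+-monoʳ-≤ 2 (n<2^n d)) (*-monoˡ-≤ x (n<2^n d)) ⟩
  2 + x + x * x                      ≤⟨ +-monoˡ-≤ (x * x) (+-mono-≤ (*-monoʳ-≤ 2 1≤xx) x≤xx) ⟩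
  2 * (x * x) + x * x + x * x        ≡⟨ four x ⟩
  4 * (x * x)                        ≤⟨ *-monoʳ-≤ 4 (*-mono-≤ le le) ⟩
  4 * (2 * y * (2 * y))              ≡⟨ sixteen y ⟩
  16 * (y * y)                       <⟨ *-monoˡ-< (y * y) {{m*n≢0 y y {{y≢0}} {{y≢0}}}} (m≤m+n 17 15) ⟩
  2 ^ 5 * (y * y)                    ≤⟨ *-monoˡ-≤ (y * y) (^-monoˡ-≤ 5 2≤n) ⟩
  n ^ 5 * (y * y)                    ≡⟨ cong (λ z → n ^ 5 * (y * z)) (*-identityʳ y) ⟨
  n ^ 5 * y ^ 2                      ≡⟨ cong (n ^ 5 *_) (^-*-assoc n U 2) ⟩
  n ^ 5 * n ^ (U * 2)                ≡⟨ ^-distribˡ-+-* n 5 (U * 2) ⟨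
  n ^ wordExponent U                 ∎
  where
  open ≤-Reasoning
  x y : ℕ
  x = 2 ^ d
  y = n ^ U
  y≢0 : NonZero y
  y≢0 = m^n≢0 n U
  1≤xx : 1 ≤ x * x
  1≤xx = *-mono-≤ (m^n>0 2 d) (m^n>0 2 d)
  x≤xx : x ≤ x * x
  x≤xx = m≤m*n x x {{m^n≢0 2 d}}
  regroup : ∀ d x → suc (2 + x + d * x) + d ≡ 2 + suc d + suc d * x
  regroup = solve-∀
  four : ∀ x → 2 * (x * x) + x * x + x * x ≡ 4 * (x * x)
  four = solve-∀
  sixteen : ∀ y → 4 * (2 * y * (2 * y)) ≡ 16 * (y * y)
  sixteen = solve-∀

-- Vectors as single words

module Encoding (w : ℕ) {{w≢0 : NonZero w}} where
  open RAM w

  block-zero : ∀ {d} (v : Vec Bool d) → block v 0 ≡ word (value v)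
  block-zero v = go (w * 0) (*-zeroʳ w)
    where
    -- Abstracting `w * 0` allows replacing it by 0 together with the instance that depends on it.
    go : ∀ k → k ≡ 0 → word (_/_ (value v) (2 ^ k) {{m^n≢0 2 k}}) ≡ word (value v)
    go _ refl = cong word (n/1≡n (value v))

  single-block : ∀ {d} → 0 < d → d ≤ w → (d + pred w) / w ≡ 1
  single-block = go w
    where
    go : ∀ w .{{_ : NonZero w}} {d} → 0 < d → d ≤ w → (d + pred w) / w ≡ 1
    go (suc w) {suc d} _ (s≤s d≤w) = begin
      (suc d + w) / suc w           ≡⟨ cong (_/ suc w) (+-suc d w) ⟨
      (d + suc w) / suc w           ≡⟨ +-distrib-/-∣ʳ d {suc w} (divides 1 (sym (*-identityˡ (suc w)))) ⟩
      d / suc w + suc w / suc w     ≡⟨ cong₂ _+_ (m<n⇒m/n≡0 (s≤s d≤w)) (n/n≡1 (suc w)) ⟩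
      1                             ∎
      where open ≡-Reasoning

  encode-word : ∀ {d} → 0 < d → d ≤ w → (u : Vec Bool d) → encode u ≡ [ word (value u) ]
  encode-word 0<d d≤w u =
    trans (cong (applyUpTo (block u)) (single-block 0<d d≤w)) (cong [_] (block-zero u))

  concatMap-encode : ∀ {d} → 0 < d → d ≤ w → (us : List (Vec Bool d)) →
    concatMap encode us ≡ map (λ u → word (value u)) us
  concatMap-encode 0<d d≤w []       = refl
  concatMap-encode 0<d d≤w (u ∷ us) =
    cong₂ _++_ (encode-word 0<d d≤w u) (concatMap-encode 0<d d≤w us)

-- The data structure and the theorem

module Structure (w : ℕ) {{w≢0 : NonZero w}} {d : ℕ} (0<d : 0 < d)
  (room : suc (imageSize d) + d < 2 ^ w) (S : List (Vec Bool d)) where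
  open RAM w hiding (size)
  open Words w
  open Members S
  open Encoding w

  N : ℕ → ℕ
  N = nth (image leafPointer)

  size : ℕ
  size = imageSize d

  size≤2^w : size ≤ 2 ^ w
  size≤2^w = ≤-trans (m≤n+m size 2) (m+n≤o⇒m≤o (suc (suc size)) room)

  structure : DataStructure
  structure = record { size = size ; fits = size≤2^w ; cells = λ i → word (N (toℕ i)) }

  B<size : suc (2 ^ d) < size
  B<size = m≤m+n (2 + 2 ^ d) (d * 2 ^ d)

  open Query w {d} N size room B<size refl (image-boundary leafPointer)
  open Run w {d} N size 2^d<size

  -- The root table alone has 2^d cells, so a memory that holds the structure has words long enough
  -- for a whole vector.
  d<w : d < w
  d<w = 2^-cancel-< (<-≤-trans 2^d<size size≤2^w)

  word-inject : ∀ i → word (toℕ i) ≡ inject≤ i size≤2^w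
  word-inject i = trans (cong word (sym (toℕ-inject≤ i size≤2^w))) (word-toℕ _)

  holds⇒intact : ∀ {M} → Holds M structure → Intact M
  holds⇒intact {M} holds {a} a< = subst (λ a → M (word a) ≡ word (N a)) (toℕ-fromℕ< a<)
    (trans (cong M (word-inject (fromℕ< a<))) (holds (fromℕ< a<)))

  intact⇒holds : ∀ {M} → Intact M → Holds M structure
  intact⇒holds {M} intact i = trans (cong M (sym (word-inject i))) (intact (toℕ<n i))

  answers-queries : AnswersQueries search 16 structure S
  answers-queries v M holds = answers member v , lists-answers v , respond
    (query v (image-answer member leafPointer (leaf-answer N size) v) (block-zero v) (holds⇒intact {M} holds))
    where
    us : List (Vec Bool d)
    us = answers member v
    respond : (∃[ k ] k ≤ 16 * (1 ⊔ length us) × ∃[ R′ ] ∃[ M′ ]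
        initial v M ⟶[ k ] state 21 R′ M′ (map emit us) × Intact M′) →
      ∃[ k ] k ≤ 16 * (1 ⊔ length us) × (let s = run search k (initial v M) in
        Halted search s × out s ≡ concatMap encode us × Holds (mem s) structure)
    respond (k , bound , _ , M′ , by eq , intact) = k , bound ,
      cong (fetch search ∘ pc) eq ,
      trans (cong out eq) (sym (concatMap-encode 0<d (<⇒≤ d<w) us)) ,
      subst (λ s → Holds (mem s) structure) (sym eq) (intact⇒holds {M′} intact)

theorem8 : (c : ℝ) → 1< c →
    ∃[ κ₀ ] ∀ (κ₁ : ℕ) (w : ℕ → ℕ) {{_ : ∀ {n} → NonZero (w n)}} → LogBounds κ₀ κ₁ w →
    ∃[ P ] ∃[ K ] ∃[ h ] Subpolynomial h ×
    (∀ n → 2 ≤ n → ∀ d → RoundsLog c n d →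
    ∀ (S : List (Vec Bool d)) → Unique S → length S ≡ n →
    Σ[ D ∈ RAM.DataStructure (w n) ]
    AtMost RAM.DataStructure.size D TimesPower (h n) n c ×
    RAM.AnswersQueries (w n) P K D S)
theorem8 c _ with natural-upper c
... | U , c<U = wordExponent U , λ κ₁ w bounds →
  search , 16 , overhead U , overhead-subpolynomial U ,
  λ where
    n@(suc _) 2≤n d ((p , q , p/q<c , lt) , _) S unique |S|≡n →
      let bound = rounding-bound c {n} {d} {p} {suc q} p/q<c lt
          2^d≤ : 2 ^ d ≤ 2 * n ^ U
          2^d≤ = subst (_≤ 2 * n ^ U) (^-identityʳ (2 ^ d)) (bound {U} {1} c<U)
          -- By the choice of κ₀ the memory has room for the structure, the null entry and up to `d`
          -- pushed pointers.
          room : suc (imageSize d) + d < 2 ^ w n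
          room = <-≤-trans (memory-bound {d} {n} {U} 2≤n 2^d≤) (proj₁ (bounds n 2≤n))
          open Structure (w n) (0<dimension S unique (subst (2 ≤_) (sym |S|≡n) 2≤n)) room S
      in structure , (λ p′ q′ c<p′/q′ → imageSize-atMost {d} {n} {U} {p′} {q′} 2^d≤ (bound c<p′/q′)) , answers-queries
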